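{- Let $p$ be a prime and $k$ a positive integer, and let $n$ be a positive integer. Any matrix in $M_n(\mathbb{Z}_{p^k})$ that is diagonalizable over $\mathbb{Z}_{p^k}$ is similar (over $\mathbb{Z}_{p^k}$) to exactly one diagonal matrix, up to the ordering of its diagonal entries. That is, a diagonalizable matrix is similar to some diagonal matrix, and if it is similar to two diagonal matrices $D = \mathrm{diag}(d_1,\dots,d_n)$ and $D' = \mathrm{diag}(d_1',\dots,d_n')$ in $M_n(\mathbb{Z}_{p^k})$, then there is a permutation $\sigma \in S_n$ with $d_i = d'_{\sigma(i)}$ for all $i$.
   Context: $\mathbb{Z}_{p^k}$ denotes the ring of integers modulo $p^k$. For a commutative ring $R$ with unity, $M_n(R)$ is the ring of $n\times n$ matrices over $R$ and $GL_n(R)$ its group of invertible matrices. Matrices $A,B\in M_n(R)$ are similar (over $R$) if $B = PAP^{ -1}$ for some $P\in GL_n(R)$. A matrix $A \in M_n(R)$ is diagonalizable over $R$ if $A = PDP^{ -1}$ for some $P\in GL_n(R)$ and some diagonal matrix $D\in M_n(R)$. -}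

module Defs where

open import Algebra.Bundles using (CommutativeRing)
import Algebra.Definitions as AlgebraDefinitions
import Algebra.Properties.Monoid.Sum as MonoidSum
open import Data.Bool.Base using (if_then_else_)
open import Data.Fin.Base using (Fin)
open import Data.Fin.Properties using (_≟_)
open import Data.Integer.Base as ℤ using (ℤ; +_)
import Data.Integer.Properties as ℤₚ
open import Data.Integer.Divisibility.Signed
  using (_∣_; divides; ∣m∣n⇒∣m+n; ∣m⇒∣-m; ∣m⇒∣m*n; ∣n⇒∣m*n)
open import Data.Integer.Tactic.RingSolver using (solve-∀)
open import Data.Nat.Base using (ℕ)
open import Data.Product.Base using (Σ-syntax; ∃-syntax; _,_)
open import Data.Vec.Functional using (Vector)
open import Level using (Level; 0ℓ; _⊔_)
open import Relation.Binary.PropositionalEquality as ≡ using (_≡_)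
open import Relation.Nullary.Decidable.Core using (does)

-- Wrapping the divisibility in a record lets Agda infer a and b from the type.
record Congruent (m : ℕ) (a b : ℤ) : Set where
  constructor congruent
  field
    divides-difference : + m ∣ a ℤ.- b

open Congruent public

private
  reflexive : ∀ m {a b} → a ≡ b → Congruent m a b
  reflexive m {a} ≡.refl = congruent (divides ℤ.0ℤ (ℤₚ.+-inverseʳ a))

  symmetric : ∀ m {a b} → Congruent m a b → Congruent m b a
  symmetric m {a} {b} (congruent d) =
    congruent (≡.subst (+ m ∣_) (lemma a b) (∣m⇒∣-m d))
    where
    lemma : ∀ a b → ℤ.- (a ℤ.- b) ≡ b ℤ.- a
    lemma = solve-∀

  transitive : ∀ m {a b c} → Congruent m a b → Congruent m b c → Congruent m a c
  transitive m {a} {b} {c} (congruent d) (congruent e) =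
    congruent (≡.subst (+ m ∣_) (lemma a b c) (∣m∣n⇒∣m+n d e))
    where
    lemma : ∀ a b c → (a ℤ.- b) ℤ.+ (b ℤ.- c) ≡ a ℤ.- c
    lemma = solve-∀

  +-congruent : ∀ m {a b c d} → Congruent m a b → Congruent m c d →
                Congruent m (a ℤ.+ c) (b ℤ.+ d)
  +-congruent m {a} {b} {c} {d} (congruent x) (congruent y) =
    congruent (≡.subst (+ m ∣_) (lemma a b c d) (∣m∣n⇒∣m+n x y))
    where
    lemma : ∀ a b c d → (a ℤ.- b) ℤ.+ (c ℤ.- d) ≡ (a ℤ.+ c) ℤ.- (b ℤ.+ d)
    lemma = solve-∀

  *-congruent : ∀ m {a b c d} → Congruent m a b → Congruent m c d →
                Congruent m (a ℤ.* c) (b ℤ.* d)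
  *-congruent m {a} {b} {c} {d} (congruent x) (congruent y) =
    congruent (≡.subst (+ m ∣_) (lemma a b c d)
      (∣m∣n⇒∣m+n (∣m⇒∣m*n c x) (∣n⇒∣m*n b y)))
    where
    lemma : ∀ a b c d →
            (a ℤ.- b) ℤ.* c ℤ.+ b ℤ.* (c ℤ.- d) ≡ a ℤ.* c ℤ.- b ℤ.* d
    lemma = solve-∀

  -‿congruent : ∀ m {a b} → Congruent m a b → Congruent m (ℤ.- a) (ℤ.- b)
  -‿congruent m {a} {b} (congruent d) =
    congruent (≡.subst (+ m ∣_) (lemma a b) (∣m⇒∣-m d))
    where
    lemma : ∀ a b → ℤ.- (a ℤ.- b) ≡ ℤ.- a ℤ.- (ℤ.- b)
    lemma = solve-∀

-- The quotient ring ℤ/mℤ as a setoid: elements are represented by integers,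
-- and two representatives are equal when they are congruent modulo m.
ℤmod : ℕ → CommutativeRing 0ℓ 0ℓ
ℤmod m = record
  { Carrier = ℤ
  ; _≈_     = Congruent m
  ; _+_     = ℤ._+_
  ; _*_     = ℤ._*_
  ; -_      = ℤ.-_
  ; 0#      = ℤ.0ℤ
  ; 1#      = ℤ.1ℤ
  ; isCommutativeRing = record
    { isRing = record
      { +-isAbelianGroup = record
        { isGroup = record
          { isMonoid = record
            { isSemigroup = record
              { isMagma = record
                { isEquivalence = record
                  { refl  = reflexive m ≡.refl
                  ; sym   = symmetric m
                  ; trans = transitive m
                  }
                ; ∙-cong = +-congruent m
                }
              ; assoc = λ a b c → reflexive m (ℤₚ.+-assoc a b c)
              }
            ; identity = (λ a → reflexive m (ℤₚ.+-identityˡ a))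
                       , (λ a → reflexive m (ℤₚ.+-identityʳ a))
            }
          ; inverse = (λ a → reflexive m (ℤₚ.+-inverseˡ a))
                    , (λ a → reflexive m (ℤₚ.+-inverseʳ a))
          ; ⁻¹-cong = -‿congruent m
          }
        ; comm = λ a b → reflexive m (ℤₚ.+-comm a b)
        }
      ; *-cong = *-congruent m
      ; *-assoc = λ a b c → reflexive m (ℤₚ.*-assoc a b c)
      ; *-identity = (λ a → reflexive m (ℤₚ.*-identityˡ a))
                   , (λ a → reflexive m (ℤₚ.*-identityʳ a))
      ; distrib = (λ a b c → reflexive m (ℤₚ.*-distribˡ-+ a b c))
                , (λ a b c → reflexive m (ℤₚ.*-distribʳ-+ a b c))
      }
    ; *-comm = λ a b → reflexive m (ℤₚ.*-comm a b)
    }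
  }

module Matrices {c ℓ : Level} (R : CommutativeRing c ℓ) where

  open CommutativeRing R using (Carrier; _≈_; _*_; 0#; 1#; +-monoid)
  open MonoidSum +-monoid using (sum)

  infix  4 _≋_
  infixl 7 _·_
  infix  8 _⁻¹

  Matrix : ℕ → Set c
  Matrix n = Fin n → Fin n → Carrier

  _≋_ : ∀ {n} → Matrix n → Matrix n → Set ℓ
  A ≋ B = ∀ i j → A i j ≈ B i j

  _·_ : ∀ {n} → Matrix n → Matrix n → Matrix n
  (A · B) i j = sum (λ l → A i l * B l j)

  diag : ∀ {n} → Vector Carrier n → Matrix n
  diag d i j = if does (i ≟ j) then d i else 0#

  𝟙 : ∀ {n} → Matrix n
  𝟙 = diag (λ _ → 1#)

  GL : ℕ → Set (c ⊔ ℓ)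
  GL n = Σ[ P ∈ Matrix n ] Invertible 𝟙 _·_ P
    where open AlgebraDefinitions (_≋_ {n}) using (Invertible)

  ⟦_⟧ : ∀ {n} → GL n → Matrix n
  ⟦ P , _ ⟧ = P

  _⁻¹ : ∀ {n} → GL n → Matrix n
  (_ , P⁻¹ , _) ⁻¹ = P⁻¹

  Similar : ∀ {n} → Matrix n → Matrix n → Set (c ⊔ ℓ)
  Similar {n} A B = Σ[ P ∈ GL n ] B ≋ ⟦ P ⟧ · A · P ⁻¹

  Diagonalizable : ∀ {n} → Matrix n → Set (c ⊔ ℓ)
  Diagonalizable {n} A =
    Σ[ P ∈ GL n ] ∃[ d ] A ≋ ⟦ P ⟧ · diag d · P ⁻¹

{-# OPTIONS --safe #-}

-- Passing through A, the two diagonal matrices satisfy Q D = D′ Q with Q invertible, that is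
-- Q i j * d j = d′ i * Q i j.  As ℤ/pᵏ is local and Q has a left inverse, some entry Q i 0 of
-- column 0 is a unit, whence d 0 = d′ i.  The Schur complement of that entry again has a left
-- inverse and again intertwines the remaining diagonal entries, so one concludes by induction.
module Submission where

open import Defs
open import Algebra.Bundles using (CommutativeRing; Monoid)
import Algebra.Properties.CommutativeSemigroup as CommutativeSemigroupProperties
import Algebra.Properties.CommutativeSemigroup.Divisibility as CommutativeSemigroupDivisibility
import Algebra.Properties.Monoid as MonoidProperties
import Algebra.Properties.Ring as RingProperties
import Algebra.Properties.Semiring.Sum as SemiringSum
open import Data.Fin.Base using (Fin; zero; suc; punchIn)
open import Data.Fin.Permutation using (Permutation′; _⟨$⟩ʳ_; id; insert)
open import Data.Fin.Properties using (_≟_; punchInᵢ≢i)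
open import Data.Integer.Base as ℤ using (ℤ; +_)
import Data.Integer.Divisibility.Signed as ℤ∣
import Data.Integer.Properties as ℤₚ
open import Data.Integer.Tactic.RingSolver using (solve-∀)
open import Data.Nat.Base as ℕ using (ℕ; _^_; NonZero; zero; suc)
open import Data.Nat.Coprimality using (Coprime; coprime-Bézout)
import Data.Nat.Divisibility as ℕ∣
open import Data.Nat.GCD using (module Bézout)
import Data.Nat.Properties as ℕₚ
open import Data.Nat.Primality using (Prime; prime⇒irreducible; prime⇒nonTrivial)
open import Data.Product.Base using (_×_; ∃-syntax; Σ-syntax; _,_; proj₁; proj₂)
open import Data.Sum.Base using (_⊎_; inj₁; inj₂)
open import Data.Vec.Functional using (Vector)
open import Function.Base using (_∘_)
open import Level using (Level; _⊔_)
open import Relation.Binary.PropositionalEquality as ≡ using (_≡_; _≢_)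
import Relation.Binary.Reasoning.Setoid as SetoidReasoning
open import Relation.Nullary using (¬_; contradiction; yes; no)
open import Relation.Nullary.Decidable using (dec-true; dec-false)

-- Matrix algebra over a commutative ring.

module MatrixProperties {c ℓ : Level} (R : CommutativeRing c ℓ) where

  open CommutativeRing R hiding (zero)
  open Matrices R
  open SemiringSum semiring
  open CommutativeSemigroupProperties *-commutativeSemigroup
  open CommutativeSemigroupDivisibility *-commutativeSemigroup
  open MonoidProperties *-monoid using (cancelˡ)
  open RingProperties ring using (-‿distribˡ-*)
  open SetoidReasoning setoid

  sum-zero : ∀ {n} {t : Vector Carrier n} → (∀ i → t i ≈ 0#) → sum t ≈ 0#
  sum-zero {n} t≈0 = trans (sum-cong-≋ t≈0) (sum-replicate-zero n)

  sum-single : ∀ {n} (t : Vector Carrier n) i → (∀ j → j ≢ i → t j ≈ 0#) → sum t ≈ t i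
  sum-single {suc _} t i others≈0 = begin
    sum t                          ≈⟨ sum-remove t ⟩
    t i + sum (t ∘ punchIn i)      ≈⟨ +-congˡ (sum-zero λ j → others≈0 _ (punchInᵢ≢i i j)) ⟩
    t i + 0#                       ≈⟨ +-identityʳ _ ⟩
    t i                            ∎

  diag-≡ : ∀ {n} (d : Vector Carrier n) i → diag d i i ≈ d i
  diag-≡ d i rewrite dec-true (i ≟ i) ≡.refl = refl

  diag-≢ : ∀ {n} (d : Vector Carrier n) {i j} → i ≢ j → diag d i j ≈ 0#
  diag-≢ d {i} {j} i≢j rewrite dec-false (i ≟ j) i≢j = refl

  ·-diag : ∀ {n} (A : Matrix n) d i j → (A · diag d) i j ≈ A i j * d j
  ·-diag A d i j = begin
    sum (λ l → A i l * diag d l j) ≈⟨ sum-single _ j (λ l l≢j → trans (*-congˡ (diag-≢ d l≢j)) (zeroʳ _)) ⟩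
    A i j * diag d j j             ≈⟨ *-congˡ (diag-≡ d j) ⟩
    A i j * d j                    ∎

  diag-· : ∀ {n} d (A : Matrix n) i j → (diag d · A) i j ≈ d i * A i j
  diag-· d A i j = begin
    sum (λ l → diag d i l * A l j) ≈⟨ sum-single _ i (λ l l≢i → trans (*-congʳ (diag-≢ d (l≢i ∘ ≡.sym))) (zeroˡ _)) ⟩
    diag d i i * A i j             ≈⟨ *-congʳ (diag-≡ d i) ⟩
    d i * A i j                    ∎

  ·-assoc : ∀ {n} (A B C : Matrix n) → (A · B) · C ≋ A · (B · C)
  ·-assoc {n} A B C i j = begin
    sum (λ l → sum (λ m → A i m * B m l) * C l j)
      ≈⟨ sum-cong-≋ {n} (λ l → *-distribʳ-sum (C l j) (λ m → A i m * B m l)) ⟩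
    sum (λ l → sum (λ m → A i m * B m l * C l j))
      ≈⟨ ∑-comm (λ l m → A i m * B m l * C l j) ⟩
    sum (λ m → sum (λ l → A i m * B m l * C l j))
      ≈⟨ sum-cong-≋ {n} (λ m → sum-cong-≋ {n} (λ l → *-assoc (A i m) (B m l) (C l j))) ⟩
    sum (λ m → sum (λ l → A i m * (B m l * C l j)))
      ≈⟨ sum-cong-≋ {n} (λ m → *-distribˡ-sum (A i m) (λ l → B m l * C l j)) ⟨
    sum (λ m → A i m * sum (λ l → B m l * C l j))   ∎

  -- Bundled so that the generic cancellation lemmas for monoids apply to products of a matrix with
  -- its inverse.
  ·-𝟙-monoid : ℕ → Monoid c ℓ
  ·-𝟙-monoid n = record
    { Carrier  = Matrix n
    ; _≈_      = _≋_
    ; _∙_      = _·_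
    ; ε        = 𝟙
    ; isMonoid = record
      { isSemigroup = record
        { isMagma = record
          { isEquivalence = record
            { refl  = λ i j → refl
            ; sym   = λ A≋B i j → sym (A≋B i j)
            ; trans = λ A≋B B≋C i j → trans (A≋B i j) (B≋C i j)
            }
          ; ∙-cong = λ A≋B C≋D i j → sum-cong-≋ λ l → *-cong (A≋B i l) (C≋D l j)
          }
        ; assoc = ·-assoc
        }
      ; identity = (λ A i j → trans (diag-· _ A i j) (*-identityˡ _))
                 , (λ A i j → trans (·-diag A _ i j) (*-identityʳ _))
      }
    }

  -- From similarity to intertwining relations.

  Intertwines : ∀ {n} → Matrix n → Vector Carrier n → Vector Carrier n → Set ℓ
  Intertwines Q d d′ = ∀ i j → Q i j * d j ≈ d′ i * Q i j

  -- `Diagonalizable` conjugates the diagonal matrix into `A` while `Similar` conjugates `A` into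
  -- it, so `P` and its inverse exchange roles.
  diagonalizable⇒similar-diag : ∀ {n} {A : Matrix n} → Diagonalizable A → ∃[ d ] Similar A (diag d)
  diagonalizable⇒similar-diag {n} {A} ((P , P⁻ , P⁻P , PP⁻) , d , A≋PDP⁻) =
    d , (P⁻ , P , PP⁻ , P⁻P) , D≋P⁻AP
    where
    module M = Monoid (·-𝟙-monoid n)
    open MonoidProperties (·-𝟙-monoid n) using () renaming (cancelʳ to ·-cancelʳ; cancelˡ to ·-cancelˡ)

    D≋P⁻AP : diag d ≋ P⁻ · A · P
    D≋P⁻AP = M.sym (M.trans (M.∙-congʳ (M.∙-congˡ A≋PDP⁻))
      (M.trans (M.∙-congʳ (M.sym (M.assoc P⁻ (P · diag d) P⁻)))
      (M.trans (·-cancelʳ P⁻P (P⁻ · (P · diag d)))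
               (·-cancelˡ P⁻P (diag d)))))

  -- If `P` and `S` conjugate `A` to the two diagonal matrices, then `S · P⁻` intertwines them. Its
  -- inverse is recorded as a left inverse, the form that passes to the Schur complement.
  similar-diags⇒intertwiner : ∀ {n} {A : Matrix n} {d d′} → Similar A (diag d) → Similar A (diag d′) →
    ∃[ Q ] ∃[ B ] (B · Q ≋ 𝟙 × Intertwines Q d d′)
  similar-diags⇒intertwiner {n} {A} {d} {d′} ((P , P⁻ , P⁻P , PP⁻) , D≋PAP⁻) ((S , S⁻ , S⁻S , _) , D′≋SAS⁻) =
    S · P⁻ , P · S⁻
    , M.trans (·-cancelᶜ S⁻S P P⁻) PP⁻
    , λ i j → trans (sym (·-diag (S · P⁻) d i j)) (trans (QD≋D′Q i j) (diag-· d′ (S · P⁻) i j))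
    where
    module M = Monoid (·-𝟙-monoid n)
    open MonoidProperties (·-𝟙-monoid n) using () renaming (cancelᶜ to ·-cancelᶜ)

    QD≋D′Q : (S · P⁻) · diag d ≋ diag d′ · (S · P⁻)
    -- The chain is `S P⁻ D = S A P⁻ = S A S⁻ S P⁻ = D′ S P⁻`.
    QD≋D′Q = M.trans (M.∙-congˡ (M.trans D≋PAP⁻ (M.assoc P A P⁻)))
      (M.trans (·-cancelᶜ P⁻P S (A · P⁻))
      (M.trans (M.sym (M.assoc S A P⁻))
      (M.trans (M.sym (·-cancelᶜ S⁻S (S · A) P⁻))
               (M.∙-congʳ (M.sym D′≋SAS⁻)))))

  -- Elimination with a unit pivot.

  module SchurComplement {n} (Q : Matrix (suc n)) (i : Fin (suc n)) (u : Carrier) (u*Qᵢ₀≈1 : u * Q i zero ≈ 1#) where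

    -- The multiple of column `zero` which, added to column `suc y`, clears the entry in the pivot
    -- row `i`.
    multiplier : Vector Carrier n
    multiplier y = - u * Q i (suc y)

    -- Defined on the pivot row too, so that a sum over the rows of `complement` can be completed to
    -- a sum over all rows of `Q`.
    eliminate : Fin (suc n) → Vector Carrier n
    eliminate a y = Q a (suc y) + Q a zero * multiplier y

    complement : Matrix n
    complement x = eliminate (punchIn i x)

    eliminate-pivot : ∀ y → eliminate i y ≈ 0#
    eliminate-pivot y = begin
      q + Q i zero * (- u * q)     ≈⟨ +-congˡ (x∙yz≈yx∙z _ _ _) ⟩
      q + (- u * Q i zero) * q     ≈⟨ +-cong (*-identityˡ q) (*-congʳ (-‿distribˡ-* u (Q i zero))) ⟨
      1# * q + - (u * Q i zero) * q ≈⟨ +-congˡ (*-congʳ (-‿cong u*Qᵢ₀≈1)) ⟩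
      1# * q + - 1# * q            ≈⟨ distribʳ q 1# (- 1#) ⟨
      (1# + - 1#) * q              ≈⟨ *-congʳ (-‿inverseʳ 1#) ⟩
      0# * q                       ≈⟨ zeroˡ q ⟩
      0#                           ∎
      where
      q = Q i (suc y)

    -- The left inverse is `B` without row `zero` and column `i`. The missing term vanishes because
    -- elimination clears the pivot row, and the column operation alters `B · Q` only by multiples
    -- of its column `zero`, which is zero in the rows `suc x`.
    complement-leftInverse : ∀ {B} → B · Q ≋ 𝟙 → (λ x a → B (suc x) (punchIn i a)) · complement ≋ 𝟙
    complement-leftInverse {B} BQ≋𝟙 x y = begin
      sum (f ∘ punchIn i)
        ≈⟨ +-identityˡ _ ⟨
      0# + sum (f ∘ punchIn i)
        ≈⟨ +-congʳ (trans (*-congˡ (eliminate-pivot y)) (zeroʳ _)) ⟨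
      f i + sum (f ∘ punchIn i)
        ≈⟨ sum-remove f ⟨
      sum f
        ≈⟨ sum-cong-≋ {suc n} (λ a → trans (distribˡ (b a) (Q a (suc y)) _) (+-congˡ (sym (*-assoc (b a) (Q a zero) m)))) ⟩
      sum (λ a → b a * Q a (suc y) + b a * Q a zero * m)
        ≈⟨ ∑-distrib-+ (λ a → b a * Q a (suc y)) (λ a → b a * Q a zero * m) ⟩
      (B · Q) (suc x) (suc y) + sum (λ a → b a * Q a zero * m)
        ≈⟨ +-congˡ (*-distribʳ-sum m (λ a → b a * Q a zero)) ⟨
      (B · Q) (suc x) (suc y) + (B · Q) (suc x) zero * m
        -- By computation, `𝟙 (suc x) (suc y)` is `𝟙 x y` and `𝟙 (suc x) zero` is `0#`.
        ≈⟨ +-cong (BQ≋𝟙 (suc x) (suc y)) (trans (*-congʳ (BQ≋𝟙 (suc x) zero)) (zeroˡ m)) ⟩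
      𝟙 x y + 0#
        ≈⟨ +-identityʳ _ ⟩
      𝟙 x y ∎
      where
      b = B (suc x)
      m = multiplier y
      f : Vector Carrier (suc n)
      f a = b a * eliminate a y

    module _ {d d′} (intertwines : Intertwines Q d d′) where

      -- The unit pivot cancels from the intertwining relation at row `i`, column `zero`.
      pivot-≈ : d zero ≈ d′ i
      pivot-≈ = begin
        d zero                  ≈⟨ cancelˡ u*Qᵢ₀≈1 _ ⟨
        u * (Q i zero * d zero) ≈⟨ *-congˡ (intertwines i zero) ⟩
        u * (d′ i * Q i zero)   ≈⟨ *-congˡ (*-comm _ _) ⟩
        u * (Q i zero * d′ i)   ≈⟨ cancelˡ u*Qᵢ₀≈1 _ ⟩
        d′ i                    ∎

      -- The multiplier is a scalar multiple of row `i` of `Q`, so it inherits that row's relation,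
      -- with `d′ i` replaced by the equal `d zero`.
      multiplier-intertwines : ∀ y → multiplier y * d (suc y) ≈ d zero * multiplier y
      multiplier-intertwines y = begin
        - u * Q i (suc y) * d (suc y)   ≈⟨ *-assoc _ _ _ ⟩
        - u * (Q i (suc y) * d (suc y)) ≈⟨ *-congˡ (intertwines i (suc y)) ⟩
        - u * (d′ i * Q i (suc y))      ≈⟨ *-congˡ (*-congʳ pivot-≈) ⟨
        - u * (d zero * Q i (suc y))    ≈⟨ x∙yz≈y∙xz _ _ _ ⟩
        d zero * multiplier y           ∎

      -- In the correction term, `d (suc y)` moves past the multiplier as `d zero`, which then moves
      -- past `Q a zero` as `d′ a`.
      complement-intertwines : Intertwines complement (d ∘ suc) (d′ ∘ punchIn i)
      complement-intertwines x y = begin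
        (Q a (suc y) + Q a zero * m) * d (suc y)
          ≈⟨ distribʳ _ _ _ ⟩
        Q a (suc y) * d (suc y) + Q a zero * m * d (suc y)
          ≈⟨ +-cong (intertwines a (suc y)) (*-assoc _ _ _) ⟩
        d′ a * Q a (suc y) + Q a zero * (m * d (suc y))
          ≈⟨ +-congˡ (*-congˡ (multiplier-intertwines y)) ⟩
        d′ a * Q a (suc y) + Q a zero * (d zero * m)
          ≈⟨ +-congˡ (*-assoc _ _ _) ⟨
        d′ a * Q a (suc y) + Q a zero * d zero * m
          ≈⟨ +-congˡ (*-congʳ (intertwines a zero)) ⟩
        d′ a * Q a (suc y) + d′ a * Q a zero * m
          ≈⟨ +-congˡ (*-assoc _ _ _) ⟩
        d′ a * Q a (suc y) + d′ a * (Q a zero * m)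
          ≈⟨ distribˡ _ _ _ ⟨
        d′ a * (Q a (suc y) + Q a zero * m) ∎
        where
        a = punchIn i x
        m = multiplier y

  -- The elementwise form of locality, with `x ∣ 1#` for "x is a unit"; it yields a unit entry
  -- directly, with no mention of maximal ideals.
  Local : Set (c ⊔ ℓ)
  Local = 0# ∤ 1# × (∀ x y → x + y ∣ 1# → x ∣ 1# ⊎ y ∣ 1#)

  -- The permutation over a local ring.

  module _ (local : Local) where

    unit-summand : ∀ {n} (t : Vector Carrier n) → sum t ∣ 1# → ∃[ i ] t i ∣ 1#
    -- The empty sum is `0#`, so this case rests on the ring being nontrivial.
    unit-summand {zero} t 0∣1 = contradiction 0∣1 (proj₁ local)
    unit-summand {suc _} t sum∣1 with proj₂ local _ _ sum∣1
    ... | inj₁ head∣1 = zero , head∣1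
    ... | inj₂ tail∣1 with i , tᵢ∣1 ← unit-summand (t ∘ suc) tail∣1 = suc i , tᵢ∣1

    intertwined⇒permuted : ∀ {n} {Q B : Matrix n} {d d′} → B · Q ≋ 𝟙 → Intertwines Q d d′ →
      Σ[ σ ∈ Permutation′ n ] (∀ j → d j ≈ d′ (σ ⟨$⟩ʳ j))
    intertwined⇒permuted {zero} _ _ = id , λ ()
    intertwined⇒permuted {suc _} {Q} {B} {d} {d′} BQ≋𝟙 intertwines
      -- The entry of `B · Q` at `zero`, `zero` is a sum equal to `1#`, so one of its terms is a
      -- unit.
      with i , BQ∣1 ← unit-summand (λ a → B zero a * Q a zero) (1# , trans (*-identityˡ _) (BQ≋𝟙 zero zero))
      -- A factor of a unit is a unit, which makes `Q i zero` a pivot with inverse `u`.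
      with u , uQ≈1 ← ∣-trans (B zero i , refl) BQ∣1
      = let open SchurComplement Q i u uQ≈1
            σ , d≈d′σ = intertwined⇒permuted (complement-leftInverse {B} BQ≋𝟙)
                                             (complement-intertwines {d} {d′} intertwines)
        -- `insert zero i σ` sends `zero` to `i` and computes on `suc j` to `punchIn i (σ ⟨$⟩ʳ j)`,
        -- matching the rows kept in the complement.
        in insert zero i σ , λ where
          zero    → pivot-≈ {d} {d′} intertwines
          (suc j) → d≈d′σ j

-- Inverses modulo a prime and its powers.

module _ {p : ℕ} (pr : Prime p) where

  p∤1 : ¬ p ℕ∣.∣ 1
  p∤1 p∣1 = ℕ.nonTrivial⇒≢1 {{prime⇒nonTrivial pr}} (ℕ∣.∣1⇒≡1 p∣1)

  prime∤⇒coprime : ∀ {a} → ¬ p ℕ∣.∣ a → Coprime a p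
  prime∤⇒coprime p∤a (e∣a , e∣p) with prime⇒irreducible pr e∣p
  ... | inj₁ e≡1    = e≡1
  ... | inj₂ ≡.refl = contradiction e∣a p∤a

InverseMod : ℕ → ℤ → ℤ → Set
InverseMod m a b = Congruent m (b ℤ.* a) ℤ.1ℤ

-- Bézout over the naturals has two cases, according to which side carries the extra 1; the second
-- yields the negated coefficient. The factor `q`, with `|a| = q a`, accounts for the sign of `a`.
coprime⇒inverse : ∀ a {m} → Coprime ℤ.∣ a ∣ m → ∃[ b ] InverseMod m a b
coprime⇒inverse a {m} coprime with ℤ∣.m∣∣m∣ {a} | coprime-Bézout coprime
... | ℤ∣.divides q ∣a∣≡qa | Bézout.+- x y 1+ym≡x∣a∣ = + x ℤ.* q , congruent (ℤ∣.divides (+ y) (begin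
    + x ℤ.* q ℤ.* a ℤ.- ℤ.1ℤ           ≡⟨ ≡.cong (ℤ._- ℤ.1ℤ) (ℤₚ.*-assoc (+ x) q a) ⟩
    + x ℤ.* (q ℤ.* a) ℤ.- ℤ.1ℤ         ≡⟨ ≡.cong (λ z → + x ℤ.* z ℤ.- ℤ.1ℤ) ∣a∣≡qa ⟨
    + x ℤ.* + ℤ.∣ a ∣ ℤ.- ℤ.1ℤ         ≡⟨ ≡.cong (ℤ._- ℤ.1ℤ) (ℤₚ.pos-* x ℤ.∣ a ∣) ⟨
    + (x ℕ.* ℤ.∣ a ∣) ℤ.- ℤ.1ℤ         ≡⟨ ≡.cong (λ z → + z ℤ.- ℤ.1ℤ) 1+ym≡x∣a∣ ⟨
    + (1 ℕ.+ y ℕ.* m) ℤ.- ℤ.1ℤ         ≡⟨ ≡.cong (ℤ._- ℤ.1ℤ) (ℤₚ.pos-+ 1 (y ℕ.* m)) ⟩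
    (ℤ.1ℤ ℤ.+ + (y ℕ.* m)) ℤ.- ℤ.1ℤ    ≡⟨ cancel (+ (y ℕ.* m)) ⟩
    + (y ℕ.* m)                        ≡⟨ ℤₚ.pos-* y m ⟩
    + y ℤ.* + m                        ∎))
  where
  open ≡.≡-Reasoning
  cancel : ∀ z → (ℤ.1ℤ ℤ.+ z) ℤ.- ℤ.1ℤ ≡ z
  cancel = solve-∀
... | ℤ∣.divides q ∣a∣≡qa | Bézout.-+ x y 1+x∣a∣≡ym = ℤ.- (+ x ℤ.* q) , congruent (ℤ∣.divides (ℤ.- + y) (begin
    ℤ.- (+ x ℤ.* q) ℤ.* a ℤ.- ℤ.1ℤ     ≡⟨ rearrange (+ x) q a ⟩
    ℤ.- (ℤ.1ℤ ℤ.+ + x ℤ.* (q ℤ.* a))   ≡⟨ ≡.cong (λ z → ℤ.- (ℤ.1ℤ ℤ.+ + x ℤ.* z)) ∣a∣≡qa ⟨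
    ℤ.- (ℤ.1ℤ ℤ.+ + x ℤ.* + ℤ.∣ a ∣)   ≡⟨ ≡.cong (λ z → ℤ.- (ℤ.1ℤ ℤ.+ z)) (ℤₚ.pos-* x ℤ.∣ a ∣) ⟨
    ℤ.- (ℤ.1ℤ ℤ.+ + (x ℕ.* ℤ.∣ a ∣))   ≡⟨ ≡.cong ℤ.-_ (ℤₚ.pos-+ 1 (x ℕ.* ℤ.∣ a ∣)) ⟨
    ℤ.- + (1 ℕ.+ x ℕ.* ℤ.∣ a ∣)        ≡⟨ ≡.cong (λ z → ℤ.- + z) 1+x∣a∣≡ym ⟩
    ℤ.- + (y ℕ.* m)                    ≡⟨ ≡.cong ℤ.-_ (ℤₚ.pos-* y m) ⟩
    ℤ.- (+ y ℤ.* + m)                  ≡⟨ ℤₚ.neg-distribˡ-* (+ y) (+ m) ⟩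
    ℤ.- + y ℤ.* + m                    ∎))
  where
  open ≡.≡-Reasoning
  rearrange : ∀ x q a → ℤ.- (x ℤ.* q) ℤ.* a ℤ.- ℤ.1ℤ ≡ ℤ.- (ℤ.1ℤ ℤ.+ x ℤ.* (q ℤ.* a))
  rearrange = solve-∀

-- Multiply the two congruences b a − 1 ≡ 0 and c a − 1 ≡ 0.
inverse-* : ∀ {l m} a b c → InverseMod l a b → InverseMod m a c →
            InverseMod (l ℕ.* m) a (b ℤ.+ c ℤ.- b ℤ.* c ℤ.* a)
inverse-* {l} {m} a b c (congruent (ℤ∣.divides q ba-1≡ql)) (congruent (ℤ∣.divides r ca-1≡rm)) =
  congruent (ℤ∣.divides (ℤ.- (q ℤ.* r)) (begin
    (b ℤ.+ c ℤ.- b ℤ.* c ℤ.* a) ℤ.* a ℤ.- ℤ.1ℤ          ≡⟨ factor a b c ⟩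
    ℤ.- ((b ℤ.* a ℤ.- ℤ.1ℤ) ℤ.* (c ℤ.* a ℤ.- ℤ.1ℤ))     ≡⟨ ≡.cong₂ (λ x y → ℤ.- (x ℤ.* y)) ba-1≡ql ca-1≡rm ⟩
    ℤ.- ((q ℤ.* + l) ℤ.* (r ℤ.* + m))                   ≡⟨ regroup q r (+ l) (+ m) ⟩
    ℤ.- (q ℤ.* r) ℤ.* (+ l ℤ.* + m)                     ≡⟨ ≡.cong (ℤ.- (q ℤ.* r) ℤ.*_) (ℤₚ.pos-* l m) ⟨
    ℤ.- (q ℤ.* r) ℤ.* + (l ℕ.* m)                       ∎))
  where
  open ≡.≡-Reasoning
  factor : ∀ a b c → (b ℤ.+ c ℤ.- b ℤ.* c ℤ.* a) ℤ.* a ℤ.- ℤ.1ℤ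
                   ≡ ℤ.- ((b ℤ.* a ℤ.- ℤ.1ℤ) ℤ.* (c ℤ.* a ℤ.- ℤ.1ℤ))
  factor = solve-∀
  regroup : ∀ q r l m → ℤ.- ((q ℤ.* l) ℤ.* (r ℤ.* m)) ≡ ℤ.- (q ℤ.* r) ℤ.* (l ℤ.* m)
  regroup = solve-∀

inverse-^ : ∀ {m} k a b → InverseMod m a b → ∃[ c ] InverseMod (m ^ k) a c
-- Modulo `m ^ 0`, which is 1, any integer is an inverse; zero is chosen.
inverse-^ zero    _ _ _   = ℤ.0ℤ , congruent (ℤ∣.divides (ℤ.- ℤ.1ℤ) ≡.refl)
inverse-^ (suc k) a b inv with c , invᵏ ← inverse-^ k a b inv =
  b ℤ.+ c ℤ.- b ℤ.* c ℤ.* a , inverse-* a b c inv invᵏ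

-- Locality of the integers modulo a prime power.

module _ {p k : ℕ} (pr : Prime p) .{{_ : NonZero k}} where

  open CommutativeSemigroupDivisibility (CommutativeRing.*-commutativeSemigroup (ℤmod (p ^ k))) using (_∣_; _,_)

  p∣pᵏ : p ℕ∣.∣ p ^ k
  -- As `k` is nonzero, it is the successor of `ℕ.pred k`, which exposes a factor `p`.
  p∣pᵏ = ≡.subst (λ e → p ℕ∣.∣ p ^ e) (ℕₚ.suc-pred k) (ℕ∣.m∣m*n (p ^ ℕ.pred k))

  -- Primality gives an inverse modulo `p`, which is then lifted to `p ^ k`.
  p∤⇒unit : ∀ a → ¬ p ℕ∣.∣ ℤ.∣ a ∣ → a ∣ ℤ.1ℤ
  p∤⇒unit a p∤a with b , inv ← coprime⇒inverse a (prime∤⇒coprime pr p∤a)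
    with c , invᵏ ← inverse-^ k a b inv = c , invᵏ

  unit⇒p∤ : ∀ a → a ∣ ℤ.1ℤ → ¬ p ℕ∣.∣ ℤ.∣ a ∣
  unit⇒p∤ a (b , congruent pᵏ∣ba-1) p∣a = p∤1 pr (ℤ∣.∣⇒∣ᵤ p∣1)
    where
    p∣ba : + p ℤ∣.∣ b ℤ.* a
    p∣ba = ℤ∣.∣n⇒∣m*n b (ℤ∣.∣ᵤ⇒∣ p∣a)

    p∣ba-1 : + p ℤ∣.∣ b ℤ.* a ℤ.- ℤ.1ℤ
    p∣ba-1 = ℤ∣.∣-trans (ℤ∣.∣ᵤ⇒∣ p∣pᵏ) pᵏ∣ba-1

    p∣1 : + p ℤ∣.∣ ℤ.- ℤ.1ℤ
    -- The difference of the two multiples of `p` is -1; passing to absolute values later drops the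
    -- sign.
    p∣1 = ℤ∣.∣m+n∣m⇒∣n p∣ba-1 p∣ba

  -- The units are exactly the classes of integers prime to `p`, and the multiples of `p` are closed
  -- under addition.
  ℤmod-pᵏ-local : MatrixProperties.Local (ℤmod (p ^ k))
  ℤmod-pᵏ-local = (λ 0∣1 → unit⇒p∤ ℤ.0ℤ 0∣1 (p ℕ∣.∣0)) , split
    where
    split : ∀ x y → (x ℤ.+ y) ∣ ℤ.1ℤ → x ∣ ℤ.1ℤ ⊎ y ∣ ℤ.1ℤ
    split x y x+y∣1 with p ℕ∣.∣? ℤ.∣ x ∣ | p ℕ∣.∣? ℤ.∣ y ∣
    ... | no p∤x  | _       = inj₁ (p∤⇒unit x p∤x)
    ... | yes _   | no p∤y  = inj₂ (p∤⇒unit y p∤y)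
    ... | yes p∣x | yes p∣y = contradiction
      (ℤ∣.∣⇒∣ᵤ (ℤ∣.∣m∣n⇒∣m+n (ℤ∣.∣ᵤ⇒∣ {+ p} {x} p∣x) (ℤ∣.∣ᵤ⇒∣ {+ p} {y} p∣y))) (unit⇒p∤ (x ℤ.+ y) x+y∣1)

theorem2p1 : (p k n : ℕ) → Prime p → .{{_ : NonZero k}} → .{{_ : NonZero n}} →
    let module R = CommutativeRing (ℤmod (p ^ k))
        open Matrices (ℤmod (p ^ k)) in
    (A : Matrix n) → Diagonalizable A →
      (∃[ d ] Similar A (diag d))
      ×
      ((d d′ : Vector R.Carrier n) → Similar A (diag d) → Similar A (diag d′) →
        Σ[ σ ∈ Permutation′ n ] (∀ i → d i R.≈ d′ (σ ⟨$⟩ʳ i)))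
theorem2p1 p k n pr A diagonalizable =
  diagonalizable⇒similar-diag diagonalizable , λ d d′ A∼D A∼D′ →
    let Q , B , BQ≋𝟙 , intertwines = similar-diags⇒intertwiner A∼D A∼D′
    in intertwined⇒permuted (ℤmod-pᵏ-local pr) {Q = Q} {B} {d} {d′} BQ≋𝟙 intertwines
  where open MatrixProperties (ℤmod (p ^ k))
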